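{- There is an infinite sequence of connected asymmetric graphs $G$, with orders tending to infinity, such that $$\operatorname{psd}(G)\ge |V(G)|-O\!\left(\frac{(\log|V(G)|)^2}{\log\log|V(G)|}\right),$$ where the implied constant is absolute. Moreover, every intermediate graph in the corresponding active chain is connected and asymmetric. That is, there are an absolute constant $C$ and, for each graph $G$ of the sequence, an active pseudosimilarity chain $v_1,\ldots,v_k$ in $G$ of length $k\ge |V(G)|-C\,(\log|V(G)|)^2/\log\log|V(G)|$ such that each of the graphs $G-\{v_1,\ldots,v_j\}$, $0\le j\le k$, is connected and asymmetric.
   Context: All graphs are finite and simple. A graph is asymmetric if its only automorphism is the identity. For a graph $G$ and vertices $u,v\in V(G)$: $u,v$ are similar if some automorphism of $G$ maps $u$ to $v$; they are removal-similar if $G-u\cong G-v$; they are pseudosimilar if they are removal-similar but not similar. A pseudosimilar mate of $v$ in $G$ is a vertex $u$ of $G$ such that $u,v$ are pseudosimilar in $G$. An active pseudosimilarity chain of length $k$ in $G$ is a sequence of distinct vertices $v_1,\ldots,v_k$ of $G$ such that, for each $j=0,\ldots,k-1$, writing $G_j=G-\{v_1,\ldots,v_j\}$ (so $G_0=G$), the vertex $v_{j+1}$ has a pseudosimilar mate in $G_j$. The pseudosimilarity depth $\operatorname{psd}(G)$ is the maximum $k$ such that $G$ has an active pseudosimilarity chain of length $k$ (the empty chain has length $0$). -}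

module Defs where

open import Data.Bool using (Bool; false; T)
import Data.Bool.Properties as Bool
open import Data.Fin using (Fin; zero; suc; toℕ)
open import Data.Fin.Properties using (_≟_; any?; all?; injective⇒≤)
import Data.Fin.Subset as Subset
open import Data.Fin.Subset using (Subset; _∈_; ∣_∣; Nonempty)
open import Data.Fin.Subset.Properties using (_∈?_)
open import Data.List using (List; []; _∷_; length; lookup; take; foldl)
open import Data.List.Membership.Propositional.Properties using (∈-lookup)
import Data.List.Relation.Unary.All as All
open import Data.List.Relation.Unary.All using (All)
open import Data.List.Relation.Unary.AllPairs using ([]; _∷_)
open import Data.List.Relation.Unary.Unique.Propositional using (Unique)
import Data.List.Relation.Unary.Unique.DecPropositional as DecUnique
open import Data.Nat using (ℕ; zero; suc; _≤_; _≤?_; _*_; _∸_; _^_)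
open import Data.Nat.Logarithm using (⌊log₂_⌋)
open import Data.Nat.Properties using (≤-antisym; ≰⇒>)
open import Data.Product using (∃; ∃-syntax; Σ-syntax; _×_; _,_; proj₁; proj₂)
import Data.Vec.Functional as Vector
open import Function using (_∘_)
open import Relation.Binary using (Rel)
open import Relation.Binary.Construct.Closure.ReflexiveTransitive using (Star)
open import Relation.Binary.PropositionalEquality
open import Relation.Nullary using (¬_; Dec; yes; no; contradiction)
open import Relation.Nullary.Decidable using (map′; ¬?; _×-dec_; _→-dec_)
open import Relation.Unary using (Pred; Decidable)
open import Level using (0ℓ)

-- A finite simple graph whose vertex set V is an arbitrary subset of the label
-- set Fin n, so that vertices keep their names when other vertices are deleted.
-- Only the values of adj on V matter: every notion below is restricted to V.
record Graph (n : ℕ) : Set where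
  field
    V          : Subset n
    adj        : Fin n → Fin n → Bool
    adj-sym    : ∀ u v → adj u v ≡ adj v u
    adj-irrefl : ∀ v → adj v v ≡ false

open Graph public

private
  variable
    n : ℕ

order : Graph n → ℕ
order G = ∣ V G ∣

infixl 6 _-_ _∖_

_-_ : Graph n → Fin n → Graph n
G - v = record
  { V          = V G Subset.- v
  ; adj        = adj G
  ; adj-sym    = adj-sym G
  ; adj-irrefl = adj-irrefl G
  }

_∖_ : Graph n → List (Fin n) → Graph n
_∖_ = foldl _-_

Edge : Graph n → Rel (Fin n) 0ℓ
Edge G u v = u ∈ V G × v ∈ V G × T (adj G u v)

Connected : Graph n → Set
Connected G =
  Nonempty (V G) × (∀ u v → u ∈ V G → v ∈ V G → Star (Edge G) u v)

-- Mutually inverse bijections between V G and V H; the values of the two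
-- functions outside the vertex sets are irrelevant.
record IsIsomorphism (G H : Graph n) (to from : Fin n → Fin n) : Set where
  field
    to-∈    : ∀ v → v ∈ V G → to v ∈ V H
    from-∈  : ∀ v → v ∈ V H → from v ∈ V G
    from∘to : ∀ v → v ∈ V G → from (to v) ≡ v
    to∘from : ∀ v → v ∈ V H → to (from v) ≡ v
    to-adj  : ∀ u v → u ∈ V G → v ∈ V G → adj H (to u) (to v) ≡ adj G u v

infix 4 _≅_

record _≅_ (G H : Graph n) : Set where
  field
    to from       : Fin n → Fin n
    isIsomorphism : IsIsomorphism G H to from

open _≅_ public

Automorphism : Graph n → Set
Automorphism G = G ≅ G

Asymmetric : Graph n → Set
Asymmetric G = (φ : Automorphism G) → ∀ v → v ∈ V G → to φ v ≡ v

Similar : Graph n → Rel (Fin n) 0ℓ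
Similar G u v = Σ[ φ ∈ Automorphism G ] to φ u ≡ v

RemovalSimilar : Graph n → Rel (Fin n) 0ℓ
RemovalSimilar G u v = (G - u) ≅ (G - v)

Pseudosimilar : Graph n → Rel (Fin n) 0ℓ
Pseudosimilar G u v =
  u ∈ V G × v ∈ V G × RemovalSimilar G u v × ¬ Similar G u v

HasPseudosimilarMate : Graph n → Fin n → Set
HasPseudosimilarMate G v = ∃[ u ] Pseudosimilar G u v

-- With vs = v₁, …, v_k, the entry of vs at the (0-based) position j is v_{j+1},
-- and G ∖ take j vs is G_j = G − {v₁, …, v_j}.
record IsActiveChain (G : Graph n) (vs : List (Fin n)) : Set where
  field
    vertices : All (_∈ V G) vs
    distinct : Unique vs
    mates    : (j : Fin (length vs)) →
               HasPseudosimilarMate (G ∖ take (toℕ j) vs) (lookup vs j)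

HasActiveChain : Graph n → ℕ → Set
HasActiveChain G k = ∃[ vs ] length vs ≡ k × IsActiveChain G vs

IsMaximum : Pred ℕ 0ℓ → ℕ → Set
IsMaximum P m = P m × (∀ k → P k → k ≤ m)

-- The maximum defining psd exists because having an active chain of length k
-- is decidable, holds for k = 0, and fails for k > n.

private
  anyFunction? : ∀ {m} {P : Pred (Fin m → Fin n) 0ℓ} →
                 (∀ {f g} → f ≗ g → P f → P g) →
                 Decidable P → Dec (∃ P)
  anyFunction? {m = zero} resp P? =
    map′ (_ ,_) (λ (f , p) → resp (λ ()) p) (P? λ ())
  anyFunction? {m = suc m} resp P? =
    map′ (λ (x , f , p) → x Vector.∷ f , p)
         (λ (f , p) → f zero , f ∘ suc ,
                      resp (λ { zero → refl ; (suc i) → refl }) p)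
         (any? λ x → anyFunction?
           (λ f≗g → resp λ { zero → refl ; (suc i) → f≗g i })
           (λ f → P? (x Vector.∷ f)))

  all∈? : (S : Subset n) {P : Pred (Fin n) 0ℓ} →
          Decidable P → Dec (∀ v → v ∈ S → P v)
  all∈? S P? = all? λ v → (v ∈? S) →-dec P? v

  isIsomorphism? : (G H : Graph n) (f g : Fin n → Fin n) →
                   Dec (IsIsomorphism G H f g)
  isIsomorphism? G H f g =
    map′ (λ (a , b , c , d , e) → record
           { to-∈ = a ; from-∈ = b ; from∘to = c ; to∘from = d
           ; to-adj = λ u v p q → e u p v q })
         (λ i → let open IsIsomorphism i in
           to-∈ , from-∈ , from∘to , to∘from , λ u p v q → to-adj u v p q)
         (all∈? (V G) (λ v → f v ∈? V H)
          ×-dec all∈? (V H) (λ v → g v ∈? V G)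
          ×-dec all∈? (V G) (λ v → g (f v) ≟ v)
          ×-dec all∈? (V H) (λ v → f (g v) ≟ v)
          ×-dec all∈? (V G) (λ u → all∈? (V G)
                  (λ v → adj H (f u) (f v) Bool.≟ adj G u v)))

  isIsomorphism-resp : (G H : Graph n) {f f′ g g′ : Fin n → Fin n} →
                       f ≗ f′ → g ≗ g′ →
                       IsIsomorphism G H f g → IsIsomorphism G H f′ g′
  isIsomorphism-resp G H {f} {f′} {g} {g′} p q i = record
    { to-∈    = λ v v∈ → subst (_∈ V H) (p v) (to-∈ v v∈)
    ; from-∈  = λ v v∈ → subst (_∈ V G) (q v) (from-∈ v v∈)
    ; from∘to = λ v v∈ → trans (sym (trans (cong g (p v)) (q (f′ v)))) (from∘to v v∈)
    ; to∘from = λ v v∈ → trans (sym (trans (cong f (q v)) (p (g′ v)))) (to∘from v v∈)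
    ; to-adj  = λ u v u∈ v∈ →
        trans (sym (cong₂ (adj H) (p u) (p v))) (to-adj u v u∈ v∈)
    }
    where open IsIsomorphism i

  anyIso? : (G H : Graph n) {P : Pred (Fin n → Fin n) 0ℓ} →
            (∀ {f g} → f ≗ g → P f → P g) → Decidable P →
            Dec (Σ[ φ ∈ G ≅ H ] P (to φ))
  anyIso? G H {P} resp P? =
    map′ (λ (f , p , g , i) → record { to = f ; from = g ; isIsomorphism = i } , p)
         (λ (φ , p) → to φ , p , from φ , isIsomorphism φ)
         (anyFunction?
           {P = λ f → P f × ∃ (IsIsomorphism G H f)}
           (λ eq (p , g , i) → resp eq p , g , isIsomorphism-resp G H eq (λ _ → refl) i)
           (λ f → P? f ×-dec anyFunction?
             (λ eq → isIsomorphism-resp G H (λ _ → refl) eq)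
             (isIsomorphism? G H f)))

  similar? : (G : Graph n) (u v : Fin n) → Dec (Similar G u v)
  similar? G u v =
    anyIso? G G (λ eq p → trans (sym (eq u)) p) (λ f → f u ≟ v)

  removalSimilar? : (G : Graph n) (u v : Fin n) → Dec (RemovalSimilar G u v)
  removalSimilar? G u v =
    map′ proj₁ (_, refl)
      (anyIso? (G - u) (G - v) {P = λ _ → u ≡ u} (λ _ p → p) (λ _ → yes refl))

  hasPseudosimilarMate? : (G : Graph n) (v : Fin n) →
                          Dec (HasPseudosimilarMate G v)
  hasPseudosimilarMate? G v = any? λ u →
    (u ∈? V G) ×-dec (v ∈? V G)
    ×-dec removalSimilar? G u v ×-dec ¬? (similar? G u v)

  isActiveChain? : (G : Graph n) → Decidable (IsActiveChain G)
  isActiveChain? G vs =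
    map′ (λ (a , b , c) → record { vertices = a ; distinct = b ; mates = c })
         (λ c → let open IsActiveChain c in vertices , distinct , mates)
         (All.all? (_∈? V G) vs
          ×-dec DecUnique.unique? _≟_ vs
          ×-dec all? (λ j → hasPseudosimilarMate? (G ∖ take (toℕ j) vs) (lookup vs j)))

  anyList? : {P : Pred (List (Fin n)) 0ℓ} → Decidable P →
             ∀ k → Dec (∃[ vs ] length vs ≡ k × P vs)
  anyList? P? zero =
    map′ (λ p → [] , refl , p) (λ { ([] , _ , p) → p }) (P? [])
  anyList? P? (suc k) =
    map′ (λ { (v , vs , refl , p) → v ∷ vs , refl , p })
         (λ { (v ∷ vs , refl , p) → v , vs , refl , p })
         (any? λ v → anyList? (P? ∘ (v ∷_)) k)

  lookup-injective : {xs : List (Fin n)} → Unique xs →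
                     ∀ {i j} → lookup xs i ≡ lookup xs j → i ≡ j
  lookup-injective (_ ∷ _) {zero} {zero} _ = refl
  lookup-injective {xs = _ ∷ xs} (x∉ ∷ _) {zero} {suc j} eq =
    contradiction eq (All.lookup x∉ (∈-lookup j))
  lookup-injective {xs = _ ∷ xs} (x∉ ∷ _) {suc i} {zero} eq =
    contradiction (sym eq) (All.lookup x∉ (∈-lookup i))
  lookup-injective (_ ∷ u) {suc i} {suc j} eq = cong suc (lookup-injective u eq)

  hasActiveChain⇒≤ : (G : Graph n) → ∀ k → HasActiveChain G k → k ≤ n
  hasActiveChain⇒≤ G _ (vs , refl , c) =
    injective⇒≤ (lookup-injective (IsActiveChain.distinct c))

  hasActiveChain-0 : (G : Graph n) → HasActiveChain G 0
  hasActiveChain-0 G = [] , refl , record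
    { vertices = All.[] ; distinct = [] ; mates = λ () }

  maximum : {P : Pred ℕ 0ℓ} → Decidable P → P 0 →
            ∀ b → (∀ k → P k → k ≤ b) → ∃ (IsMaximum P)
  maximum P? p₀ zero bound = 0 , p₀ , bound
  maximum {P} P? p₀ (suc b) bound with P? (suc b)
  ... | yes p = suc b , p , bound
  ... | no ¬p = maximum P? p₀ b bound′
    where
    bound′ : ∀ k → P k → k ≤ b
    bound′ k p with k ≤? b
    ... | yes k≤b = k≤b
    ... | no k≰b = contradiction (subst P (≤-antisym (bound k p) (≰⇒> k≰b)) p) ¬p

  psd-exists : (G : Graph n) → ∃ (IsMaximum (HasActiveChain G))
  psd-exists {n} G =
    maximum (anyList? (isActiveChain? G)) (hasActiveChain-0 G) n (hasActiveChain⇒≤ G)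

abstract
  psd : Graph n → ℕ
  psd G = proj₁ (psd-exists G)

  psd-isMaximum : (G : Graph n) → IsMaximum (HasActiveChain G) (psd G)
  psd-isMaximum G = proj₂ (psd-exists G)

TendsToInfinity : (ℕ → ℕ) → Set
TendsToInfinity a = ∀ N → ∃[ i₀ ] (∀ i → i₀ ≤ i → N ≤ a i)

-- k ≥ N − C (log N)² / log log N, with the denominator cleared. If N ≥ 4, then
-- L = ⌊log₂ N⌋ satisfies L ≤ log₂ N < 2 L, and M = ⌊log₂ L⌋ = ⌊log₂ log₂ N⌋ ≥ 1
-- satisfies M ≤ log₂ log₂ N < 2 M. So taking floors, like changing the base of
-- the logarithm, alters (log N)² / log log N only by a factor between positive
-- absolute constants, which C absorbs. For N < 4 the bound is void.
AtLeastUpToLogError : (C N k : ℕ) → Set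
AtLeastUpToLogError C N k =
  (N ∸ k) * ⌊log₂ ⌊log₂ N ⌋ ⌋ ≤ C * ⌊log₂ N ⌋ ^ 2

{-# OPTIONS --safe #-}
module Submission where

-- In fact psd(G) ≥ |V(G)| − 11 for infinitely many graphs G, which is stronger
-- than the claimed bound.
--
-- Take a path w₀, w₁, …, w_{L−1} and join w_j to the vertices c_{j mod 3} and
-- d_{j mod 3} of a six-vertex core: the c's form a triangle, c_s is joined to
-- d_{s+1} (indices mod 3), and there are no other core edges. The rotation
-- s ↦ s + 1 is a symmetry of the core, so the shift w_j ↦ w_{j+1} shows that
-- deleting either end of the path gives isomorphic graphs (shift-iso). But a
-- reflection s ↦ const − s of the indices of both the c's and the d's is not a
-- symmetry of the core, and so the path cannot be reversed. Two more vertices,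
-- a hub joined to every w_j and a leaf joined to the hub, make the parts
-- recognisable: the leaf is the only vertex of degree one, the hub is its
-- neighbour, and the w's are the other neighbours of the hub. Hence every
-- automorphism preserves the set of w's and that of core vertices, and even that
-- of c's, since a d has only one neighbour in the core. An edge
-- w_j w_{j+1} is oriented intrinsically by the core edge c_j d_{j+1}, and so an
-- automorphism acts on the path by j ↦ j + const, where the constant can only be
-- 0. The core then is fixed as well as soon as L ≥ 3 (automorphism-fixes).
--
-- So the ends of the path are pseudosimilar, and deleting the last path vertex
-- leaves a graph of the same shape. Starting from L = 3 + k, this gives an active
-- chain of length k in a graph of order 11 + k, through connected asymmetric
-- graphs only (descending-chain, descending-intermediate).

open import Defs
open import Data.Bool using (T; true)
open import Data.Fin using (Fin; zero; suc; toℕ)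
open import Data.Fin.Patterns using (0F; 1F; 2F)
open import Data.Fin.Properties using (toℕ-fromℕ<; toℕ-injective; toℕ<n)
  renaming (_≟_ to _≟ᶠ_)
import Data.Fin.Subset as Subset
open import Data.Fin.Subset using (Subset; _∈_)
open import Data.Fin.Subset.Properties
  using (p─q⊆p; x∈p∧x≢y⇒x∈p-y; x∈⁅x⁆; ∈⊤; ∣⊤∣≡n)
open import Data.List using (List; []; _∷_; length; take)
import Data.List.Relation.Unary.All as All
import Data.List.Relation.Unary.AllPairs as AllPairs
open import Data.Nat using (ℕ; zero; suc; _+_; _*_; _∸_; _^_; _≤_; _<_; z≤n; s≤s; s<s; z<s)
open import Data.Nat.DivMod using (_%_; _mod_; m<n⇒m%n≡m)
open import Data.Nat.Logarithm using (⌊log₂_⌋; ⌊log₂⌋-mono-≤; ⌊log₂[2^n]⌋≡n)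
import Data.Nat.Properties as ℕ
open import Data.Product using (∃-syntax; Σ-syntax; _×_; _,_; proj₁; proj₂)
open import Data.Sum using (_⊎_; inj₁; inj₂; swap; [_,_]′)
open import Data.Unit using (tt)
open import Data.Vec using (_∷_; here; there)
open import Function using (_∘_)
open import Function.Bundles using (_⇔_; mk⇔; Equivalence)
open import Level using (0ℓ)
import Relation.Binary.Construct.Closure.ReflexiveTransitive as Star
open import Relation.Binary.Construct.Closure.ReflexiveTransitive using (Star; ε; _◅_; _◅◅_)
open import Relation.Binary.PropositionalEquality
open import Relation.Nullary using (¬_; Dec; yes; no; does; contradiction)
open import Relation.Nullary.Decidable using (_⊎-dec_; map′; dec-true; dec-false; does-⇔)
open import Relation.Unary using (Pred)

open Equivalence using () renaming (to to ⇒; from to ⇐)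

-- Rotation of the residues mod 3

-- Addition of 1 modulo 3.
rot : Fin 3 → Fin 3
rot 0F = 1F
rot 1F = 2F
rot 2F = 0F

rot³ : ∀ s → rot (rot (rot s)) ≡ s
rot³ 0F = refl
rot³ 1F = refl
rot³ 2F = refl

rot-injective : ∀ {s t} → rot s ≡ rot t → s ≡ t
rot-injective {s} {t} eq = trans (sym (rot³ s)) (trans (cong (rot ∘ rot) eq) (rot³ t))

rot≢ : ∀ s → s ≢ rot s
rot≢ 0F ()
rot≢ 1F ()
rot≢ 2F ()

rot²≢ : ∀ s → s ≢ rot (rot s)
rot²≢ 0F ()
rot²≢ 1F ()
rot²≢ 2F ()

-- The residue of j modulo 3, by recursion, so that it commutes with suc
-- definitionally.
res : ℕ → Fin 3
res zero    = 0F
res (suc j) = rot (res j)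

res-toℕ : ∀ s → res (toℕ s) ≡ s
res-toℕ 0F = refl
res-toℕ 1F = refl
res-toℕ 2F = refl

-- The infinite graph of which all graphs considered are induced subgraphs

-- A leaf, a hub, the core vertices c_s and d_s for s mod 3, and a one-way infinite
-- path w₀, w₁, ….
data Vtx : Set where
  leaf hub : Vtx
  c d      : Fin 3 → Vtx
  w        : ℕ → Vtx

-- Each edge, listed in one of its two directions.
data Arc : Vtx → Vtx → Set where
  leaf-hub : Arc leaf hub
  hub-w    : ∀ {j} → Arc hub (w j)
  w-w      : ∀ {i j} → j ≡ suc i → Arc (w i) (w j)
  w-c      : ∀ {j s} → s ≡ res j → Arc (w j) (c s)
  w-d      : ∀ {j s} → s ≡ res j → Arc (w j) (d s)
  c-c      : ∀ {s t} → t ≡ rot s → Arc (c s) (c t)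
  c-d      : ∀ {s t} → t ≡ rot s → Arc (c s) (d t)

Adj : Vtx → Vtx → Set
Adj x y = Arc x y ⊎ Arc y x

arc? : ∀ x y → Dec (Arc x y)
arc? leaf  leaf  = no λ ()
arc? leaf  hub   = yes leaf-hub
arc? leaf  (c t) = no λ ()
arc? leaf  (d t) = no λ ()
arc? leaf  (w j) = no λ ()
arc? hub   leaf  = no λ ()
arc? hub   hub   = no λ ()
arc? hub   (c t) = no λ ()
arc? hub   (d t) = no λ ()
arc? hub   (w j) = yes hub-w
arc? (c s) leaf  = no λ ()
arc? (c s) hub   = no λ ()
arc? (c s) (c t) = map′ c-c (λ { (c-c e) → e }) (t ≟ᶠ rot s)
arc? (c s) (d t) = map′ c-d (λ { (c-d e) → e }) (t ≟ᶠ rot s)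
arc? (c s) (w j) = no λ ()
arc? (d s) _     = no λ ()
arc? (w i) leaf  = no λ ()
arc? (w i) hub   = no λ ()
arc? (w i) (c t) = map′ w-c (λ { (w-c e) → e }) (t ≟ᶠ res i)
arc? (w i) (d t) = map′ w-d (λ { (w-d e) → e }) (t ≟ᶠ res i)
arc? (w i) (w j) = map′ w-w (λ { (w-w e) → e }) (j ℕ.≟ suc i)

adj? : ∀ x y → Dec (Adj x y)
adj? x y = arc? x y ⊎-dec arc? y x

arc-irrefl : ∀ x → ¬ Arc x x
arc-irrefl (c s) (c-c e) = rot≢ s e
arc-irrefl (w j) (w-w e) = ℕ.1+n≢n (sym e)

adj-irreflexive : ∀ x → ¬ Adj x x
adj-irreflexive x = [ arc-irrefl x , arc-irrefl x ]′

-- The vertex set in which the path is w₀, …, w_{L−1}.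
data Upto (L : ℕ) : Pred Vtx 0ℓ where
  leaf : Upto L leaf
  hub  : Upto L hub
  c    : ∀ {s} → Upto L (c s)
  d    : ∀ {s} → Upto L (d s)
  w    : ∀ {j} → j < L → Upto L (w j)

_without_ : Pred Vtx 0ℓ → Vtx → Pred Vtx 0ℓ
(P without x) y = P y × y ≢ x

-- Isomorphism of the subgraphs induced by P and Q; adjacency is required to be
-- preserved by both maps, which makes the notion symmetric.
record InducedIso (P Q : Pred Vtx 0ℓ) : Set where
  field
    f g   : Vtx → Vtx
    f-∈   : ∀ {x} → P x → Q (f x)
    g-∈   : ∀ {x} → Q x → P (g x)
    g∘f   : ∀ {x} → P x → g (f x) ≡ x
    f∘g   : ∀ {x} → Q x → f (g x) ≡ x
    f-adj : ∀ {x y} → P x → P y → Adj x y → Adj (f x) (f y)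
    g-adj : ∀ {x y} → Q x → Q y → Adj x y → Adj (g x) (g y)

-- The shift of the path, which rotates the core

shift : Vtx → Vtx
shift leaf  = leaf
shift hub   = hub
shift (c s) = c (rot s)
shift (d s) = d (rot s)
shift (w j) = w (suc j)

-- Inverse to shift away from w₀, where the value is arbitrary.
unshift : Vtx → Vtx
unshift leaf        = leaf
unshift hub         = hub
unshift (c s)       = c (rot (rot s))
unshift (d s)       = d (rot (rot s))
unshift (w zero)    = w zero
unshift (w (suc j)) = w j

shift-arc : ∀ {x y} → Arc x y → Arc (shift x) (shift y)
shift-arc leaf-hub = leaf-hub
shift-arc hub-w    = hub-w
shift-arc (w-w e)  = w-w (cong suc e)
shift-arc (w-c e)  = w-c (cong rot e)
shift-arc (w-d e)  = w-d (cong rot e)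
shift-arc (c-c e)  = c-c (cong rot e)
shift-arc (c-d e)  = c-d (cong rot e)

unshift-arc : ∀ {x y} → x ≢ w 0 → y ≢ w 0 → Arc x y → Arc (unshift x) (unshift y)
unshift-arc _ _ leaf-hub = leaf-hub
unshift-arc _ q (hub-w {zero})          = contradiction refl q
unshift-arc _ _ (hub-w {suc _})         = hub-w
unshift-arc p _ (w-w {zero} _)          = contradiction refl p
unshift-arc _ _ (w-w {suc _} refl)      = w-w refl
unshift-arc p _ (w-c {zero} _)          = contradiction refl p
unshift-arc _ _ (w-c {suc j} refl)      = w-c (rot³ (res j))
unshift-arc p _ (w-d {zero} _)          = contradiction refl p
unshift-arc _ _ (w-d {suc j} refl)      = w-d (rot³ (res j))
unshift-arc _ _ (c-c e)                 = c-c (cong (rot ∘ rot) e)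
unshift-arc _ _ (c-d e)                 = c-d (cong (rot ∘ rot) e)

unshift-shift : ∀ x → unshift (shift x) ≡ x
unshift-shift leaf  = refl
unshift-shift hub   = refl
unshift-shift (c s) = cong c (rot³ s)
unshift-shift (d s) = cong d (rot³ s)
unshift-shift (w j) = refl

shift-unshift : ∀ x → x ≢ w 0 → shift (unshift x) ≡ x
shift-unshift leaf        _ = refl
shift-unshift hub         _ = refl
shift-unshift (c s)       _ = cong c (rot³ s)
shift-unshift (d s)       _ = cong d (rot³ s)
shift-unshift (w zero)    p = contradiction refl p
shift-unshift (w (suc j)) _ = refl

-- Removing the first or the last vertex of the path gives isomorphic graphs.
shift-iso : ∀ L → InducedIso (Upto (suc L) without w 0) (Upto (suc L) without w L)
shift-iso L = record
  { f     = unshift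
  ; g     = shift
  ; f-∈   = unshift-∈
  ; g-∈   = shift-∈
  ; g∘f   = λ {x} (_ , x≢) → shift-unshift x x≢
  ; f∘g   = λ {x} _ → unshift-shift x
  ; f-adj = λ { (_ , p) (_ , q) (inj₁ a) → inj₁ (unshift-arc p q a)
              ; (_ , p) (_ , q) (inj₂ a) → inj₂ (unshift-arc q p a) }
  ; g-adj = λ { _ _ (inj₁ a) → inj₁ (shift-arc a)
              ; _ _ (inj₂ a) → inj₂ (shift-arc a) }
  }
  where
  unshift-∈ : ∀ {x} → (Upto (suc L) without w 0) x →
              (Upto (suc L) without w L) (unshift x)
  unshift-∈ (leaf , _)             = leaf , λ ()
  unshift-∈ (hub , _)              = hub , λ ()
  unshift-∈ (c , _)                = c , λ ()
  unshift-∈ (d , _)                = d , λ ()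
  unshift-∈ (w {zero} _ , p)       = contradiction refl p
  unshift-∈ (w {suc j} (s<s q) , _) = w (ℕ.m<n⇒m<1+n q) , λ { refl → ℕ.<-irrefl refl q }

  shift-∈ : ∀ {x} → (Upto (suc L) without w L) x →
            (Upto (suc L) without w 0) (shift x)
  shift-∈ (leaf , _) = leaf , λ ()
  shift-∈ (hub , _)  = hub , λ ()
  shift-∈ (c , _)    = c , λ ()
  shift-∈ (d , _)    = d , λ ()
  shift-∈ (w q , p)  = w (s<s (ℕ.≤∧≢⇒< (ℕ.<⇒≤pred q) (p ∘ cong w))) , λ ()

-- Rigidity

leaf-neighbour : ∀ {y} → Adj leaf y → y ≡ hub
leaf-neighbour (inj₁ leaf-hub) = refl

hub-neighbour : ∀ {y} → Adj hub y → y ≡ leaf ⊎ ∃[ j ] y ≡ w j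
hub-neighbour (inj₁ hub-w)    = inj₂ (_ , refl)
hub-neighbour (inj₂ leaf-hub) = inj₁ refl

-- The core vertices: the c's and the d's.
data Core : Pred Vtx 0ℓ where
  c : ∀ s → Core (c s)
  d : ∀ s → Core (d s)

core≁hub : ∀ {x} → Core x → ¬ Adj hub x
core≁hub (c _) (inj₁ ())
core≁hub (c _) (inj₂ ())
core≁hub (d _) (inj₁ ())
core≁hub (d _) (inj₂ ())

core-neighbour-of-d : ∀ {x t} → Core x → Adj x (d t) → ∃[ s ] x ≡ c s × t ≡ rot s
core-neighbour-of-d (c s) (inj₁ (c-d e)) = s , refl , e

core-neighbour-of-w : ∀ {x i} → Core x → Adj (w i) x → x ≡ c (res i) ⊎ x ≡ d (res i)
core-neighbour-of-w (c s) (inj₁ (w-c e)) = inj₁ (cong c e)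
core-neighbour-of-w (d s) (inj₁ (w-d e)) = inj₂ (cong d e)

w-neighbours : ∀ {i j} → Adj (w i) (w j) → j ≡ suc i ⊎ i ≡ suc j
w-neighbours (inj₁ (w-w e)) = inj₁ e
w-neighbours (inj₂ (w-w e)) = inj₂ e

c-d-neighbours : ∀ {s t} → Adj (c s) (d t) → t ≡ rot s
c-d-neighbours (inj₁ (c-d e)) = e

-- With at least three path vertices, every core vertex has a neighbour on the path.
module Rigidity {L} (3≤L : 3 ≤ L) (φ : InducedIso (Upto L) (Upto L)) where
  open InducedIso φ

  toℕ<L : (s : Fin 3) → toℕ s < L
  toℕ<L s = ℕ.<-≤-trans (toℕ<n s) 3≤L

  core-∈ : ∀ {x} → Core x → Upto L x
  core-∈ (c _) = c
  core-∈ (d _) = d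

  f-injective : ∀ {x y} → Upto L x → Upto L y → f x ≡ f y → x ≡ y
  f-injective p q eq = trans (sym (g∘f p)) (trans (cong g eq) (g∘f q))

  -- f preserves adjacency, with the images rewritten along given equations.
  f-adj′ : ∀ {x y x′ y′} → Upto L x → Upto L y → f x ≡ x′ → f y ≡ y′ →
           Adj x y → Adj x′ y′
  f-adj′ p q eq eq′ a = subst₂ Adj eq eq′ (f-adj p q a)

  two-neighbours : ∀ {x} → Upto L x → x ≡ leaf ⊎
    ∃[ y ] ∃[ z ] Upto L y × Upto L z × y ≢ z × Adj x y × Adj x z
  two-neighbours leaf      = inj₁ refl
  two-neighbours hub       = inj₂
    (leaf , w 0 , leaf , w (toℕ<L 0F) , (λ ()) , inj₂ leaf-hub , inj₁ hub-w)
  two-neighbours (c {s})   = inj₂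
    (c (rot s) , d (rot s) , c , d , (λ ()) , inj₁ (c-c refl) , inj₁ (c-d refl))
  two-neighbours (d {s})   = inj₂
    (c (rot (rot s)) , w (toℕ s) , c , w (toℕ<L s) , (λ ()) ,
     inj₂ (c-d (sym (rot³ s))) , inj₂ (w-d (sym (res-toℕ s))))
  two-neighbours (w {j} _) = inj₂
    (hub , c (res j) , hub , c , (λ ()) , inj₂ hub-w , inj₁ (w-c refl))

  -- Two neighbours of f leaf would be taken by g to the only neighbour of leaf.
  f-leaf : f leaf ≡ leaf
  f-leaf with two-neighbours (f-∈ leaf)
  ... | inj₁ eq = eq
  ... | inj₂ (y , z , p , q , y≢z , a , b) = contradiction y≡z y≢z
    where
    g≡hub : ∀ {x} → Upto L x → Adj (f leaf) x → g x ≡ hub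
    g≡hub r e = leaf-neighbour (subst (λ v → Adj v (g _)) (g∘f leaf) (g-adj (f-∈ leaf) r e))

    y≡z : y ≡ z
    y≡z = trans (sym (f∘g p)) (trans (cong f (trans (g≡hub p a) (sym (g≡hub q b)))) (f∘g q))

  f-hub : f hub ≡ hub
  f-hub = leaf-neighbour (f-adj′ leaf hub f-leaf refl (inj₁ leaf-hub))

  f-w : ∀ {j} → j < L → ∃[ i ] i < L × f (w j) ≡ w i
  f-w j<L with hub-neighbour (f-adj′ hub (w j<L) f-hub refl (inj₁ hub-w))
  ... | inj₁ eq = contradiction (f-injective (w j<L) leaf (trans eq (sym f-leaf))) λ ()
  ... | inj₂ (i , eq) with subst (Upto L) eq (f-∈ (w j<L))
  ...   | w i<L = i , i<L , eq

  f-core≁hub : ∀ {x} → Core x → ¬ Adj hub (f x)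
  f-core≁hub k a = core≁hub k
    (subst₂ Adj g-hub (g∘f (core-∈ k)) (g-adj hub (f-∈ (core-∈ k)) a))
    where
    g-hub : g hub ≡ hub
    g-hub = trans (cong g (sym f-hub)) (g∘f hub)

  f-core : ∀ {x} → Core x → Core (f x)
  f-core {x} k with f x in eq
  ... | c s  = c s
  ... | d s  = d s
  ... | w i  = contradiction (subst (Adj hub) (sym eq) (inj₁ hub-w)) (f-core≁hub k)
  ... | leaf = contradiction (subst (Adj hub) (sym eq) (inj₂ leaf-hub)) (f-core≁hub k)
  ... | hub with f-injective (core-∈ k) hub (trans eq (sym f-hub))
  f-core () | hub | refl

  -- The two c's adjacent to c s cannot be taken to the same vertex, but a
  -- vertex d t has only one neighbour in the core.
  f-c : ∀ s → ∃[ t ] f (c s) ≡ c t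
  f-c s with f (c s) in eq | f-core (c s)
  ... | c t | _ = t , refl
  ... | d t | _
    with core-neighbour-of-d (f-core (c (rot s))) (f-adj′ c c refl eq (inj₂ (c-c refl)))
       | core-neighbour-of-d (f-core (c (rot (rot s)))) (f-adj′ c c refl eq (inj₁ (c-c (sym (rot³ s)))))
  ...   | u , e , p | v , e′ , q
    with f-injective c c (trans e (trans (cong c (rot-injective (trans (sym p) q))) (sym e′)))
  ...   | eq″ = contradiction (c-injective eq″) (rot≢ (rot s))
    where
    c-injective : ∀ {s t} → c s ≡ c t → s ≡ t
    c-injective refl = refl

  -- The action of f on the core is determined by that on the path.
  f-core-at-w : ∀ {j i} → j < L → f (w j) ≡ w i →
                f (c (res j)) ≡ c (res i) × f (d (res j)) ≡ d (res i)
  f-core-at-w {j} {i} j<L eq = fc , fd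
    where
    fc : f (c (res j)) ≡ c (res i)
    fc with f-c (res j) | core-neighbour-of-w (f-core (c (res j)))
                            (f-adj′ (w j<L) c eq refl (inj₁ (w-c refl)))
    ... | _      | inj₁ e  = e
    ... | t , e′ | inj₂ e = contradiction (trans (sym e′) e) λ ()

    fd : f (d (res j)) ≡ d (res i)
    fd with core-neighbour-of-w (f-core (d (res j)))
                                (f-adj′ (w j<L) d eq refl (inj₁ (w-d refl)))
    ... | inj₁ e = contradiction (f-injective d c (trans e (sym fc))) λ ()
    ... | inj₂ e = e

  -- If f reversed the direction of an edge w j – w (j + 1), then the core edge from
  -- c (res j) to d (res (j + 1)) would be taken to a pair c s, d (rot (rot s)).
  f-w-suc : ∀ {j i} → suc j < L → f (w j) ≡ w i → f (w (suc j)) ≡ w (suc i)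
  f-w-suc {j} {i} j+1<L eq with f-w j+1<L
  ... | i′ , _ , eq′ with w-neighbours (f-adj′ (w j<L) (w j+1<L) eq eq′ (inj₁ (w-w refl)))
    where j<L = ℕ.<⇒≤ j+1<L
  ...   | inj₁ refl = eq′
  ...   | inj₂ refl = contradiction
    (c-d-neighbours (f-adj′ c d (proj₁ (f-core-at-w (ℕ.<⇒≤ j+1<L) eq))
                                (proj₂ (f-core-at-w j+1<L eq′)) (inj₁ (c-d refl))))
    (rot²≢ (res i′))

  f-w-from : ∀ {i₀} → f (w 0) ≡ w i₀ → ∀ j → j < L → f (w j) ≡ w (j + i₀)
  f-w-from eq zero    _     = eq
  f-w-from eq (suc j) j+1<L = f-w-suc j+1<L (f-w-from eq j (ℕ.<⇒≤ j+1<L))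

  -- As the last path vertex has an image, the translation is trivial.
  f-w₀ : f (w 0) ≡ w 0
  f-w₀ with f-w (toℕ<L 0F)
  ... | zero   , _ , eq = eq
  ... | suc i₀ , _ , eq = contradiction last-image (ℕ.≤⇒≯ (beyond-last 3≤L))
    where
    last<L : L ∸ 1 < L
    last<L = ℕ.∸-monoʳ-< {L} z<s (ℕ.<⇒≤ (ℕ.<⇒≤ 3≤L))

    last-image : (L ∸ 1) + suc i₀ < L
    last-image with subst (Upto L) (f-w-from eq (L ∸ 1) last<L) (f-∈ (w last<L))
    ... | w q = q

    beyond-last : ∀ {m} → 3 ≤ m → m ≤ (m ∸ 1) + suc i₀
    beyond-last {suc m} _ = ℕ.m<m+n m z<s

  f-w-fixed : ∀ j → j < L → f (w j) ≡ w j
  f-w-fixed j j<L = trans (f-w-from f-w₀ j j<L) (cong w (ℕ.+-identityʳ j))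

  automorphism-fixes : ∀ {x} → Upto L x → f x ≡ x
  automorphism-fixes leaf    = f-leaf
  automorphism-fixes hub     = f-hub
  automorphism-fixes (w j<L) = f-w-fixed _ j<L
  automorphism-fixes (c {s}) = subst (λ t → f (c t) ≡ c t) (res-toℕ s)
    (proj₁ (f-core-at-w (toℕ<L s) (f-w-fixed (toℕ s) (toℕ<L s))))
  automorphism-fixes (d {s}) = subst (λ t → f (d t) ≡ d t) (res-toℕ s)
    (proj₂ (f-core-at-w (toℕ<L s) (f-w-fixed (toℕ s) (toℕ<L s))))

-- Natural numbers as labels of the vertices

-- The vertices other than path vertices come first, so that Upto L becomes the
-- initial segment of length 8 + L.
encode : Vtx → ℕ
encode leaf  = 0
encode hub   = 1
encode (c s) = 2 + toℕ s
encode (d s) = 5 + toℕ s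
encode (w j) = 8 + j

decode : ℕ → Vtx
decode 0 = leaf
decode 1 = hub
decode 2 = c 0F
decode 3 = c 1F
decode 4 = c 2F
decode 5 = d 0F
decode 6 = d 1F
decode 7 = d 2F
decode (suc (suc (suc (suc (suc (suc (suc (suc j)))))))) = w j

decode-encode : ∀ x → decode (encode x) ≡ x
decode-encode leaf   = refl
decode-encode hub    = refl
decode-encode (c 0F) = refl
decode-encode (c 1F) = refl
decode-encode (c 2F) = refl
decode-encode (d 0F) = refl
decode-encode (d 1F) = refl
decode-encode (d 2F) = refl
decode-encode (w j)  = refl

encode-decode : ∀ n → encode (decode n) ≡ n
encode-decode 0 = refl
encode-decode 1 = refl
encode-decode 2 = refl
encode-decode 3 = refl
encode-decode 4 = refl
encode-decode 5 = refl
encode-decode 6 = refl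
encode-decode 7 = refl
encode-decode (suc (suc (suc (suc (suc (suc (suc (suc j)))))))) = refl

encode-< : ∀ {L x} → Upto L x → encode x < 8 + L
encode-< leaf      = z<s
encode-< hub       = s<s z<s
encode-< {L} (c {s}) = ℕ.<-≤-trans (ℕ.+-monoʳ-< 2 (toℕ<n s)) (ℕ.m≤m+n 5 (3 + L))
encode-< {L} (d {s}) = ℕ.<-≤-trans (ℕ.+-monoʳ-< 5 (toℕ<n s)) (ℕ.m≤m+n 8 L)
encode-< (w j<L)   = ℕ.+-monoʳ-< 8 j<L

encode-<⁻ : ∀ {L} x → encode x < 8 + L → Upto L x
encode-<⁻ leaf  _ = leaf
encode-<⁻ hub   _ = hub
encode-<⁻ (c _) _ = c
encode-<⁻ (d _) _ = d
encode-<⁻ (w j) p = w (ℕ.+-cancelˡ-< 8 j _ p)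

upto-suc : ∀ {L x} → Upto L x ⇔ (Upto (suc L) without w L) x
upto-suc {L} = mk⇔ grow drop
  where
  grow : ∀ {x} → Upto L x → (Upto (suc L) without w L) x
  grow leaf    = leaf , λ ()
  grow hub     = hub , λ ()
  grow c       = c , λ ()
  grow d       = d , λ ()
  grow (w j<L) = w (ℕ.m<n⇒m<1+n j<L) , λ { refl → ℕ.<-irrefl refl j<L }

  drop : ∀ {x} → (Upto (suc L) without w L) x → Upto L x
  drop (leaf , _) = leaf
  drop (hub , _)  = hub
  drop (c , _)    = c
  drop (d , _)    = d
  drop (w q , p)  = w (ℕ.≤∧≢⇒< (ℕ.<⇒≤pred q) (p ∘ cong w))

x∈p─q⇒x∉q : ∀ {n} {x : Fin n} (p q : Subset n) → x ∈ p Subset.─ q → ¬ x ∈ q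
x∈p─q⇒x∉q (_ ∷ p) (_ ∷ q) (there i) (there j) = x∈p─q⇒x∉q p q i j
x∈p─q⇒x∉q (true ∷ p) (true ∷ q) () here

-- Finite subgraphs as graphs on labels

-- There are suc m labels, so that the label 0 always exists.
module Labelled (m : ℕ) where

  private
    n = suc m

  -- The vertex with a given label.
  vtx : Fin n → Vtx
  vtx = decode ∘ toℕ

  -- The label of x, reduced modulo n to make the function total.
  label : Vtx → Fin n
  label x = encode x mod n

  label-vtx : ∀ v → label (vtx v) ≡ v
  label-vtx v = toℕ-injective (trans (toℕ-fromℕ< _)
    (trans (cong (_% n) (encode-decode (toℕ v))) (m<n⇒m%n≡m (toℕ<n v))))

  vtx-injective : ∀ {u v} → vtx u ≡ vtx v → u ≡ v
  vtx-injective {u} {v} eq = trans (sym (label-vtx u)) (trans (cong label eq) (label-vtx v))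

  -- The subgraph induced by a set of labels.
  induced : Subset n → Graph n
  induced S = record
    { V          = S
    ; adj        = λ u v → does (adj? (vtx u) (vtx v))
    ; adj-sym    = λ u v → does-⇔ (mk⇔ swap swap) (adj? (vtx u) (vtx v)) (adj? (vtx v) (vtx u))
    ; adj-irrefl = λ v → dec-false (adj? (vtx v) (vtx v)) (adj-irreflexive (vtx v))
    }

  -- S is the set of labels of the vertices satisfying P, and all of these have
  -- a label.
  record Represents (S : Subset n) (P : Pred Vtx 0ℓ) : Set where
    field
      members   : ∀ {v} → v ∈ S ⇔ P (vtx v)
      vtx-label : ∀ {x} → P x → vtx (label x) ≡ x

    label-∈ : ∀ {x} → P x → label x ∈ S
    label-∈ p = ⇐ members (subst P (sym (vtx-label p)) p)

  open Represents

  module _ {S P S′ Q} (R : Represents S P) (R′ : Represents S′ Q) where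

    induced-iso : InducedIso P Q → induced S ≅ induced S′
    induced-iso φ = record
      { to            = label ∘ f ∘ vtx
      ; from          = label ∘ g ∘ vtx
      ; isIsomorphism = record
        { to-∈    = λ v v∈ → label-∈ R′ (f-∈ (⇒ (members R) v∈))
        ; from-∈  = λ v v∈ → label-∈ R (g-∈ (⇒ (members R′) v∈))
        ; from∘to = λ v v∈ → let p = ⇒ (members R) v∈ in
            trans (cong (label ∘ g) (vtx-label R′ (f-∈ p)))
                  (trans (cong label (g∘f p)) (label-vtx v))
        ; to∘from = λ v v∈ → let q = ⇒ (members R′) v∈ in
            trans (cong (label ∘ f) (vtx-label R (g-∈ q)))
                  (trans (cong label (f∘g q)) (label-vtx v))
        ; to-adj  = λ u v u∈ v∈ →
            let p = ⇒ (members R) u∈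
                q = ⇒ (members R) v∈
            in trans (cong₂ (λ x y → does (adj? x y)) (vtx-label R′ (f-∈ p)) (vtx-label R′ (f-∈ q)))
                     (does-⇔ (mk⇔ (λ a → subst₂ Adj (g∘f p) (g∘f q) (g-adj (f-∈ p) (f-∈ q) a))
                                  (f-adj p q))
                             (adj? _ _) (adj? _ _))
        }
      }
      where open InducedIso φ

    vertex-iso : induced S ≅ induced S′ → InducedIso P Q
    vertex-iso φ = record
      { f     = vtx ∘ to φ ∘ label
      ; g     = vtx ∘ from φ ∘ label
      ; f-∈   = λ p → ⇒ (members R′) (to-∈ _ (label-∈ R p))
      ; g-∈   = λ q → ⇒ (members R) (from-∈ _ (label-∈ R′ q))
      ; g∘f   = λ p → trans (cong (vtx ∘ from φ) (label-vtx _))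
                        (trans (cong vtx (from∘to _ (label-∈ R p))) (vtx-label R p))
      ; f∘g   = λ q → trans (cong (vtx ∘ to φ) (label-vtx _))
                        (trans (cong vtx (to∘from _ (label-∈ R′ q))) (vtx-label R′ q))
      ; f-adj = λ p q a → true⇒ (adj? _ _)
          (trans (to-adj _ _ (label-∈ R p) (label-∈ R q))
                 (dec-true (adj? _ _) (subst₂ Adj (sym (vtx-label R p)) (sym (vtx-label R q)) a)))
      ; g-adj = λ p q a → true⇒ (adj? _ _)
          (trans (sym (to-adj _ _ (from-∈ _ (label-∈ R′ p)) (from-∈ _ (label-∈ R′ q))))
          (trans (cong₂ (λ u v → does (adj? (vtx u) (vtx v)))
                        (to∘from _ (label-∈ R′ p)) (to∘from _ (label-∈ R′ q)))
                 (dec-true (adj? _ _) (subst₂ Adj (sym (vtx-label R′ p)) (sym (vtx-label R′ q)) a))))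
      }
      where
      open IsIsomorphism (isIsomorphism φ)

      true⇒ : ∀ {A : Set} (a? : Dec A) → does a? ≡ true → A
      true⇒ (yes a) _ = a

  represents-without : ∀ {S P x} → Represents S P → P x →
                       Represents (S Subset.- label x) (P without x)
  represents-without {S} {P} {x} R p = record
    { members   = mk⇔
        (λ v∈ → ⇒ (members R) (p─q⊆p _ _ v∈) ,
                λ eq → x∈p─q⇒x∉q S _ v∈ (subst (_∈ Subset.⁅ label x ⁆)
                  (vtx-injective (trans (vtx-label R p) (sym eq))) (x∈⁅x⁆ _)))
        (λ (q , v≢) → x∈p∧x≢y⇒x∈p-y (⇐ (members R) q)
                λ eq → v≢ (trans (cong vtx eq) (vtx-label R p)))
    ; vtx-label = vtx-label R ∘ proj₁
    }

  represents-resp : ∀ {S P Q} → (∀ {x} → P x ⇔ Q x) → Represents S Q → Represents S P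
  represents-resp eq R = record
    { members   = mk⇔ (⇐ eq ∘ ⇒ (members R)) (⇐ (members R) ∘ ⇒ eq)
    ; vtx-label = vtx-label R ∘ ⇒ eq
    }

  represents-upto : ∀ {L} → n ≡ 8 + L → Represents Subset.⊤ (Upto L)
  represents-upto {L} refl = record
    { members   = λ {v} → mk⇔
        (λ _ → encode-<⁻ (vtx v) (subst (_< n) (sym (encode-decode (toℕ v))) (toℕ<n v)))
        (λ _ → ∈⊤)
    ; vtx-label = λ {x} p → trans
        (cong decode (trans (toℕ-fromℕ< _) (m<n⇒m%n≡m (encode-< p)))) (decode-encode x)
    }

  -- Asymmetry and connectedness

  module _ {S L} (3≤L : 3 ≤ L) (R : Represents S (Upto L)) where

    upto-asymmetric : Asymmetric (induced S)
    upto-asymmetric φ v v∈ = vtx-injective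
      (subst (λ u → vtx (to φ u) ≡ vtx v) (label-vtx v)
        (Rigidity.automorphism-fixes 3≤L (vertex-iso R R φ) (⇒ (members R) v∈)))

    edge : ∀ {x y} → Upto L x → Upto L y → Adj x y → Edge (induced S) (label x) (label y)
    edge p q a = label-∈ R p , label-∈ R q ,
      subst T (sym (dec-true (adj? _ _)
        (subst₂ Adj (sym (vtx-label R p)) (sym (vtx-label R q)) a))) tt

    edge-sym : ∀ {u v} → Edge (induced S) u v → Edge (induced S) v u
    edge-sym {u} {v} (u∈ , v∈ , a) = v∈ , u∈ , subst T (adj-sym (induced S) u v) a

    to-hub : ∀ {x} → Upto L x → Star (Edge (induced S)) (label x) (label hub)
    to-hub leaf    = edge leaf hub (inj₁ leaf-hub) ◅ ε
    to-hub hub     = ε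
    to-hub (w j<L) = edge (w j<L) hub (inj₂ hub-w) ◅ ε
    to-hub (c {s}) = edge c (w s<L) (inj₂ (w-c (sym (res-toℕ s)))) ◅ to-hub (w s<L)
      where s<L = ℕ.<-≤-trans (toℕ<n s) 3≤L
    to-hub (d {s}) = edge d (w s<L) (inj₂ (w-d (sym (res-toℕ s)))) ◅ to-hub (w s<L)
      where s<L = ℕ.<-≤-trans (toℕ<n s) 3≤L

    upto-connected : Connected (induced S)
    upto-connected = (label hub , label-∈ R hub) , λ u v u∈ v∈ →
      walk u u∈ ◅◅ Star.reverse edge-sym (walk v v∈)
      where
      walk : ∀ u → u ∈ S → Star (Edge (induced S)) u (label hub)
      walk u u∈ = subst (λ v → Star (Edge (induced S)) v (label hub)) (label-vtx u)
                    (to-hub (⇒ (members R) u∈))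

  -- The chain of deletions

  -- The mate of the last path vertex is the first one.
  last-has-mate : ∀ {S L} → 3 ≤ L → Represents S (Upto (suc L)) →
                  HasPseudosimilarMate (induced S) (label (w L))
  last-has-mate {S} {L} 3≤L R = label (w 0) , first∈ , last∈ ,
      induced-iso (represents-without R first) (represents-without R last) (shift-iso L) ,
      λ (φ , eq) → first≢last (trans (sym (upto-asymmetric 3≤1+L R φ (label (w 0)) first∈)) eq)
    where
    3≤1+L = ℕ.m≤n⇒m≤1+n 3≤L

    first : Upto (suc L) (w 0)
    first = w z<s

    last : Upto (suc L) (w L)
    last = w ℕ.≤-refl

    first∈ = label-∈ R first
    last∈  = label-∈ R last

    first≢last : label (w 0) ≢ label (w L)
    first≢last eq with trans (sym (vtx-label R first)) (trans (cong vtx eq) (vtx-label R last))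
    ... | refl = contradiction 3≤L λ ()

  -- The labels of the last k vertices of a path with 3 + k vertices, in descending
  -- order.
  descending : ℕ → List (Fin n)
  descending zero    = []
  descending (suc k) = label (w (3 + k)) ∷ descending k

  length-descending : ∀ k → length (descending k) ≡ k
  length-descending zero    = refl
  length-descending (suc k) = cong suc (length-descending k)

  delete-last : ∀ {S L} → Represents S (Upto (suc L)) →
                Represents (S Subset.- label (w L)) (Upto L)
  delete-last R = represents-resp upto-suc (represents-without R (w ℕ.≤-refl))

  descending-chain : ∀ {S} k → Represents S (Upto (3 + k)) →
                     IsActiveChain (induced S) (descending k)
  descending-chain zero R = record
    { vertices = All.[] ; distinct = AllPairs.[] ; mates = λ () }
  descending-chain {S} (suc k) R = record
    { vertices = label-∈ R (w ℕ.≤-refl) All.∷ All.map (p─q⊆p _ _) (vertices rest)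
    ; distinct = All.map (λ v∈ eq → x∈p─q⇒x∉q S _ v∈ (subst (_∈ _) eq (x∈⁅x⁆ _))) (vertices rest)
                 AllPairs.∷ distinct rest
    ; mates    = λ { zero    → last-has-mate (ℕ.m≤m+n 3 k) R
                   ; (suc j) → mates rest j }
    }
    where
    open IsActiveChain
    rest = descending-chain k (delete-last R)

  descending-intermediate : ∀ {S} k → Represents S (Upto (3 + k)) → ∀ j →
    j ≤ length (descending k) →
    Connected (induced S ∖ take j (descending k)) × Asymmetric (induced S ∖ take j (descending k))
  descending-intermediate k R zero _ =
    upto-connected (ℕ.m≤m+n 3 k) R , upto-asymmetric (ℕ.m≤m+n 3 k) R
  descending-intermediate (suc k) R (suc j) (s≤s j≤) =
    descending-intermediate k (delete-last R) j j≤

-- The logarithmic error term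

n<2^n : ∀ n → n < 2 ^ n
n<2^n zero    = z<s
n<2^n (suc n) = ℕ.+-mono-≤ (ℕ.m^n>0 2 n) (ℕ.≤-trans (n<2^n n) (ℕ.m≤m+n (2 ^ n) 0))

⌊log₂n⌋≤n : ∀ n → ⌊log₂ n ⌋ ≤ n
⌊log₂n⌋≤n n = ℕ.≤-trans (⌊log₂⌋-mono-≤ (ℕ.<⇒≤ (n<2^n n))) (ℕ.≤-reflexive (⌊log₂[2^n]⌋≡n n))

-- As ⌊log₂ n⌋ ≤ n, the iterated logarithm of N is at most the square of the
-- logarithm.
constant-error : ∀ {C N k} → N ∸ k ≤ C → AtLeastUpToLogError C N k
constant-error {C} {N} {k} le = ℕ.*-mono-≤ le (ℕ.≤-trans (⌊log₂n⌋≤n ⌊log₂ N ⌋) (n≤n² ⌊log₂ N ⌋))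
  where
  n≤n² : ∀ n → n ≤ n ^ 2
  n≤n² zero    = z≤n
  n≤n² n@(suc _) = ℕ.≤-trans (ℕ.m≤m*n n n) (ℕ.≤-reflexive (cong (n *_) (sym (ℕ.*-identityʳ n))))

corollary6p2 : ∃[ C ] Σ[ n ∈ (ℕ → ℕ) ] Σ[ G ∈ ((i : ℕ) → Graph (n i)) ]
    TendsToInfinity (λ i → order (G i)) ×
    (∀ i →
    4 ≤ order (G i) ×
    Connected (G i) ×
    Asymmetric (G i) ×
    AtLeastUpToLogError C (order (G i)) (psd (G i)) ×
    (Σ[ vs ∈ List (Fin (n i)) ]
    IsActiveChain (G i) vs ×
    AtLeastUpToLogError C (order (G i)) (length vs) ×
    (∀ j → j ≤ length vs →
    Connected (G i ∖ take j vs) × Asymmetric (G i ∖ take j vs))))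
-- The constant counts the leaf, the hub, the six core vertices and the three path
-- vertices that are never deleted.
corollary6p2 = 11 , (11 +_) , G , tends , λ i →
  let open Labelled (10 + i)
      R     = represents-upto {3 + i} refl
      chain = descending-chain i R
      error = λ k i≤k → constant-error {11} {order (G i)} {k} (bound i k i≤k)
  in subst (4 ≤_) (sym (order≡ i)) (ℕ.m≤m+n 4 (7 + i)) ,
     upto-connected (ℕ.m≤m+n 3 i) R ,
     upto-asymmetric (ℕ.m≤m+n 3 i) R ,
     error (psd (G i)) (proj₂ (psd-isMaximum (G i)) i
                         (descending i , length-descending i , chain)) ,
     descending i , chain ,
     error (length (descending i)) (ℕ.≤-reflexive (sym (length-descending i))) ,
     descending-intermediate i R
  where
  G : ∀ i → Graph (11 + i)
  G i = Labelled.induced (10 + i) Subset.⊤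

  order≡ : ∀ i → order (G i) ≡ 11 + i
  order≡ i = ∣⊤∣≡n (11 + i)

  tends : TendsToInfinity (λ i → order (G i))
  tends N = N , λ i N≤i → subst (N ≤_) (sym (order≡ i)) (ℕ.≤-trans N≤i (ℕ.m≤n+m i 11))

  bound : ∀ i k → i ≤ k → order (G i) ∸ k ≤ 11
  bound i k i≤k = begin
    order (G i) ∸ k ≡⟨ cong (_∸ k) (order≡ i) ⟩
    (11 + i) ∸ k    ≤⟨ ℕ.∸-monoʳ-≤ (11 + i) i≤k ⟩
    (11 + i) ∸ i    ≡⟨ ℕ.m+n∸n≡m 11 i ⟩
    11              ∎
    where open ℕ.≤-Reasoning
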